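{- If $\Gamma\vdash\mathcal J$ is an LF judgment over a valid LF signature $\Sigma$ and is derivable in $\lambda^{\Pi N}$, then $\Gamma\vdash\mathcal J$ is derivable in LF.
   Context: **Syntax of $\lambda^{\Pi N}$.** Fix countable, pairwise disjoint sets of variables $x,y$, names $\mathsf a,\mathsf b$, object constants $c$, type constants $a$, and name-type constants $\alpha,\beta$. Kinds: $K::=\mathrm{type}\mid\Pi x{:}A.K$. Types (type families): $A,B::=a\mid A\,M\mid\Pi x{:}A.B\mid\alpha\mid\mathrm{New}\,\mathsf a{:}\alpha.B$. Objects: $M,N::=c\mid x\mid\lambda x{:}A.M\mid M\,N\mid\mathsf a\mid\langle\mathsf a{:}\alpha\rangle M\mid M@\mathsf a$. Signatures: $\Sigma::=\cdot\mid\Sigma,c{:}A\mid\Sigma,a{:}K\mid\Sigma,\alpha{:}\mathrm{name}$. Contexts: $\Gamma::=\cdot\mid\Gamma,x{:}A\mid\Gamma\#\mathsf a{:}\alpha$. $\Pi,\lambda$ bind $x$; $\mathrm{New}$ and $\langle\mathsf a{:}\alpha\rangle$ bind $\mathsf a$; expressions are identified up to renaming of bound variables and names, and $[M/x]$, $[\mathsf b/\mathsf a]$ are capture-avoiding. Items declared in a signature or context are distinct. All judgments except signature formation are implicitly parametrized by a signature $\Sigma$; signatures and contexts are implicitly well-formed and bound variables/names implicitly fresh. **Restriction** $\Gamma\vdash\mathsf a{:}\alpha\backslash\Gamma'$ (inductively): $\Gamma\#\mathsf a{:}\alpha\vdash\mathsf a{:}\alpha\backslash\Gamma$; if $\Gamma\vdash\mathsf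 a{:}\alpha\backslash\Gamma'$ then $\Gamma\#\mathsf b{:}\beta\vdash\mathsf a{:}\alpha\backslash\Gamma'\#\mathsf b{:}\beta$ and $\Gamma,x{:}A\vdash\mathsf a{:}\alpha\backslash\Gamma'$. **Formation.** Signatures: $\cdot$ is well-formed; a well-formed $\Sigma$ may be extended by $a{:}K$ if $\cdot\vdash K:\mathrm{kind}$, by $c{:}A$ if $\cdot\vdash A:\mathrm{type}$, by $\alpha{:}\mathrm{name}$ always. Contexts: $\cdot$ is well-formed; a well-formed $\Gamma$ may be extended by $x{:}A$ if $\Gamma\vdash A:\mathrm{type}$, by $\#\mathsf a{:}\alpha$ if $\alpha{:}\mathrm{name}\in\Sigma$. Kinds: $\Gamma\vdash\mathrm{type}:\mathrm{kind}$; if $\Gamma\vdash A:\mathrm{type}$ and $\Gamma,x{:}A\vdash K:\mathrm{kind}$ then $\Gamma\vdash\Pi x{:}A.K:\mathrm{kind}$. Types: $\Gamma\vdash a:K$ if $a{:}K\in\Sigma$; $\Gamma\vdash A\,M:K[M/x]$ if $\Gamma\vdash A:\Pi x{:}B.K$ and $\Gamma\vdash M:B$; $\Gamma\vdash\Pi x{:}A.B:\mathrm{type}$ if $\Gamma\vdash A:\mathrm{type}$ and $\Gamma,x{:}A\vdash B:\mathrm{type}$; $\Gamma\vdash\alpha:\mathrm{type}$ if $\alpha{:}\mathrm{name}\in\Sigma$; $\Gamma\vdash\mathrm{New}\,\mathsf a{:}\alpha.B:\mathrm{type}$ if $\alpha{:}\mathrm{name}\in\Sigma$ and $\Gamma\#\mathsf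 a{:}\alpha\vdash B:\mathrm{type}$; conversion: $\Gamma\vdash A:K'$ and $\Gamma\vdash K=K':\mathrm{kind}$ give $\Gamma\vdash A:K$. Objects: $\Gamma\vdash c:A$ if $c{:}A\in\Sigma$; $\Gamma\vdash x:A$ if $x{:}A\in\Gamma$; $\Gamma\vdash\mathsf a:\alpha$ if $\mathsf a{:}\alpha\in\Gamma$; $\Gamma\vdash\lambda x{:}A.M:\Pi x{:}A.B$ if $\Gamma\vdash A:\mathrm{type}$ and $\Gamma,x{:}A\vdash M:B$; $\Gamma\vdash M\,N:B[N/x]$ if $\Gamma\vdash M:\Pi x{:}A.B$ and $\Gamma\vdash N:A$; $\Gamma\vdash\langle\mathsf a{:}\alpha\rangle M:\mathrm{New}\,\mathsf a{:}\alpha.B$ if $\alpha{:}\mathrm{name}\in\Sigma$ and $\Gamma\#\mathsf a{:}\alpha\vdash M:B$; $\Gamma\vdash M@\mathsf a:B$ if $\Gamma\vdash\mathsf a{:}\alpha\backslash\Gamma'$ and $\Gamma'\vdash M:\mathrm{New}\,\mathsf a{:}\alpha.B$; conversion: $\Gamma\vdash M:A$ and $\Gamma\vdash A=B:\mathrm{type}$ give $\Gamma\vdash M:B$. **Definitional equality.** Standard LF rules. At each of the three levels: symmetry and transitivity; at the object (type) level conversion along an equal type (kind). Kinds: $\mathrm{type}=\mathrm{type}$; $\Pi x{:}A.K=\Pi x{:}B.L$ if $\Gamma\vdash A:\mathrm{type}$, $\Gamma\vdash A=B:\mathrm{type}$ and $\Gamma,x{:}A\vdash K=L:\mathrm{kind}$.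 Types: $a=a:K$ if $a{:}K\in\Sigma$; $A\,M=B\,N:K[M/x]$ if $A=B:\Pi x{:}C.K$ and $M=N:C$; $\Pi x{:}A_1.A_2=\Pi x{:}B_1.B_2:\mathrm{type}$ if $\Gamma\vdash A_1:\mathrm{type}$, $A_1=B_1:\mathrm{type}$ and $\Gamma,x{:}A_1\vdash A_2=B_2:\mathrm{type}$. Objects: $x=x:A$ and $c=c:A$ for declared $x{:}A$, $c{:}A$; $M_1M_2=N_1N_2:B[M_2/x]$ if $M_1=N_1:\Pi x{:}A.B$ and $M_2=N_2:A$; $\lambda x{:}A'.M=\lambda x{:}A''.N:\Pi x{:}A.B$ if $A'=A:\mathrm{type}$, $A''=A:\mathrm{type}$ and $\Gamma,x{:}A\vdash M=N:B$; $(\lambda x{:}A.M_2)M_1=N_2[N_1/x]:B[M_1/x]$ if $\Gamma\vdash A:\mathrm{type}$, $\Gamma,x{:}A\vdash M_2=N_2:B$ and $M_1=N_1:A$; $M=N:\Pi x{:}A.B$ if $\Gamma\vdash A:\mathrm{type}$, $\Gamma\vdash M:\Pi x{:}A.B$, $\Gamma\vdash N:\Pi x{:}A.B$ and $\Gamma,x{:}A\vdash M\,x=N\,x:B$. Type-level extensionality: $A_1=A_2:\Pi x{:}B.K$ if $\Gamma,x{:}B\vdash A_1\,x=A_2\,x:K$. Additional rules for names: $\alpha=\alpha:\mathrm{type}$ if $\alpha{:}\mathrm{name}\in\Sigma$; $\mathrm{New}\,\mathsf a{:}\alpha.A=\mathrm{New}\,\mathsf a{:}\alpha.B:\mathrm{type}$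 if $\Gamma\#\mathsf a{:}\alpha\vdash A=B:\mathrm{type}$; $\mathsf a=\mathsf a:\alpha$ if $\mathsf a{:}\alpha\in\Gamma$; $\langle\mathsf a{:}\alpha\rangle M=\langle\mathsf a{:}\alpha\rangle N:\mathrm{New}\,\mathsf a{:}\alpha.A$ if $\Gamma\#\mathsf a{:}\alpha\vdash M=N:A$; $M@\mathsf b=N@\mathsf b:A[\mathsf b/\mathsf a]$ if $\Gamma\vdash\mathsf b{:}\alpha\backslash\Gamma'$ and $\Gamma'\vdash M=N:\mathrm{New}\,\mathsf a{:}\alpha.A$; $(\langle\mathsf a{:}\alpha\rangle M)@\mathsf b=N[\mathsf b/\mathsf a]:A[\mathsf b/\mathsf a]$ if $\Gamma\vdash\mathsf b{:}\alpha\backslash\Gamma'$ and $\Gamma'\#\mathsf a{:}\alpha\vdash M=N:A$; $M=N:\mathrm{New}\,\mathsf a{:}\alpha.A$ if $\Gamma\#\mathsf a{:}\alpha\vdash M@\mathsf a=N@\mathsf a:A$. **LF.** LF is the fragment without name-type constants, names, $\mathrm{New}$-types, name-abstractions, concretions, and without $\alpha{:}\mathrm{name}$ declarations in signatures or $\#\mathsf a{:}\alpha$ entries in contexts. Its rules are exactly the rules above not mentioning these constructs (including type-level extensionality), restricted to LF expressions. $\mathcal J$ ranges over formation assertions $K:\mathrm{kind}$, $A:K$, $M:A$ and equality assertions $K=K':\mathrm{kind}$, $A=A':K$, $M=M':A$; an LF judgment is one whose context and all expressions are LF ones. A valid LF signature is an LF signature well-formed by the LF rules, and LF contexts are implicitly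 well-formed. -}

module Defs where

open import Data.Fin using (Fin; zero; suc; lift)
open import Data.List using (List; []; _∷_; map)
open import Data.List.Membership.Propositional using (_∈_; _∉_)
open import Data.Nat using (ℕ; zero; suc)
import Data.Vec.Functional as Vector
open import Function using (id; _∘_)

-- Syntax and rules are indexed by a language.  A construct or rule that
-- mentions names lives only in the instance λΠN; everything else is shared, so
-- the instance LF is exactly the name-free fragment: its derivations use only
-- the name-free rules, and every expression in them, including those that do
-- not occur in the conclusion, is an LF expression.
data Lang : Set where
  LF λΠN : Lang

data Sort : Set where
  kind ty obj : Sort

ObjConst TyConst NameConst : Set
ObjConst  = ℕ
TyConst   = ℕ
NameConst = ℕ

-- Expressions up to renaming of bound variables and names: well-scoped de
-- Bruijn syntax with two independent scopes, n variables and m names.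
infixl 9 _·_ _•_ _＠_
data Exp : Lang → Sort → ℕ → ℕ → Set where
  type : ∀ {ℓ n m} → Exp ℓ kind n m
  Πᵏ   : ∀ {ℓ n m} → Exp ℓ ty n m → Exp ℓ kind (suc n) m → Exp ℓ kind n m

  tcon : ∀ {ℓ n m} → TyConst → Exp ℓ ty n m
  _•_  : ∀ {ℓ n m} → Exp ℓ ty n m → Exp ℓ obj n m → Exp ℓ ty n m
  Π    : ∀ {ℓ n m} → Exp ℓ ty n m → Exp ℓ ty (suc n) m → Exp ℓ ty n m
  nty  : ∀ {n m} → NameConst → Exp λΠN ty n m
  New  : ∀ {n m} → NameConst → Exp λΠN ty n (suc m) → Exp λΠN ty n m

  con  : ∀ {ℓ n m} → ObjConst → Exp ℓ obj n m
  var  : ∀ {ℓ n m} → Fin n → Exp ℓ obj n m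
  ƛ    : ∀ {ℓ n m} → Exp ℓ ty n m → Exp ℓ obj (suc n) m → Exp ℓ obj n m
  _·_  : ∀ {ℓ n m} → Exp ℓ obj n m → Exp ℓ obj n m → Exp ℓ obj n m
  name : ∀ {n m} → Fin m → Exp λΠN obj n m
  ⟨_⟩_ : ∀ {n m} → NameConst → Exp λΠN obj n (suc m) → Exp λΠN obj n m
  _＠_ : ∀ {n m} → Exp λΠN obj n m → Fin m → Exp λΠN obj n m

-- Signatures are listed most recent declaration first; declared classifiers
-- are closed.
infix 5 _⦂_ _⦂⦂_ _⦂name
data Decl : Lang → Set where
  _⦂_    : ∀ {ℓ} → ObjConst → Exp ℓ ty 0 0 → Decl ℓ
  _⦂⦂_   : ∀ {ℓ} → TyConst → Exp ℓ kind 0 0 → Decl ℓ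
  _⦂name : NameConst → Decl λΠN

Sig : Lang → Set
Sig ℓ = List (Decl ℓ)

infixl 6 _,_ _#_
data Ctx : Lang → ℕ → ℕ → Set where
  ε   : ∀ {ℓ} → Ctx ℓ 0 0
  _,_ : ∀ {ℓ n m} → Ctx ℓ n m → Exp ℓ ty n m → Ctx ℓ (suc n) m
  _#_ : ∀ {n m} → Ctx λΠN n m → NameConst → Ctx λΠN n (suc m)

private variable
  ℓ : Lang
  s : Sort
  n m n′ m′ : ℕ

ren : (Fin n → Fin n′) → (Fin m → Fin m′) → Exp ℓ s n m → Exp ℓ s n′ m′
ren ξ ρ type      = type
ren ξ ρ (Πᵏ A K)  = Πᵏ (ren ξ ρ A) (ren (lift 1 ξ) ρ K)
ren ξ ρ (tcon a)  = tcon a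
ren ξ ρ (A • M)   = ren ξ ρ A • ren ξ ρ M
ren ξ ρ (Π A B)   = Π (ren ξ ρ A) (ren (lift 1 ξ) ρ B)
ren ξ ρ (nty α)   = nty α
ren ξ ρ (New α B) = New α (ren ξ (lift 1 ρ) B)
ren ξ ρ (con c)   = con c
ren ξ ρ (var x)   = var (ξ x)
ren ξ ρ (ƛ A M)   = ƛ (ren ξ ρ A) (ren (lift 1 ξ) ρ M)
ren ξ ρ (M · N)   = ren ξ ρ M · ren ξ ρ N
ren ξ ρ (name a)  = name (ρ a)
ren ξ ρ (⟨ α ⟩ M) = ⟨ α ⟩ ren ξ (lift 1 ρ) M
ren ξ ρ (M ＠ a)  = ren ξ ρ M ＠ ρ a

wk : Exp ℓ s n m → Exp ℓ s (suc n) m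
wk = ren suc id

wk# : Exp ℓ s n m → Exp ℓ s n (suc m)
wk# = ren id suc

closed : Exp ℓ s 0 0 → Exp ℓ s n m
closed = ren (λ ()) (λ ())

exts : (Fin n → Exp ℓ obj n′ m) → Fin (suc n) → Exp ℓ obj (suc n′) m
exts σ = var zero Vector.∷ (wk ∘ σ)

sub : (Fin n → Exp ℓ obj n′ m) → Exp ℓ s n m → Exp ℓ s n′ m
sub σ type      = type
sub σ (Πᵏ A K)  = Πᵏ (sub σ A) (sub (exts σ) K)
sub σ (tcon a)  = tcon a
sub σ (A • M)   = sub σ A • sub σ M
sub σ (Π A B)   = Π (sub σ A) (sub (exts σ) B)
sub σ (nty α)   = nty α
sub σ (New α B) = New α (sub (wk# ∘ σ) B)
sub σ (con c)   = con c
sub σ (var x)   = σ x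
sub σ (ƛ A M)   = ƛ (sub σ A) (sub (exts σ) M)
sub σ (M · N)   = sub σ M · sub σ N
sub σ (name a)  = name a
sub σ (⟨ α ⟩ M) = ⟨ α ⟩ sub (wk# ∘ σ) M
sub σ (M ＠ a)  = sub σ M ＠ a

-- E [ M ] is E[M/x] and E [ b ]# is E[b/a], for x, a the most recently bound.
infixl 10 _[_] _[_]#
_[_] : Exp ℓ s (suc n) m → Exp ℓ obj n m → Exp ℓ s n m
E [ M ] = sub (M Vector.∷ var) E

_[_]# : Exp ℓ s n (suc m) → Fin m → Exp ℓ s n m
E [ b ]# = ren id (b Vector.∷ id) E

infix 4 _⦂_∈ᵛ_ _⦂_∈#_ _⊢_⦂_╲_
data _⦂_∈ᵛ_ : Fin n → Exp ℓ ty n m → Ctx ℓ n m → Set where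
  here   : {Γ : Ctx ℓ n m} {A : Exp ℓ ty n m} → zero ⦂ wk A ∈ᵛ (Γ , A)
  there  : {Γ : Ctx ℓ n m} {A B : Exp ℓ ty n m} {x : Fin n} →
           x ⦂ A ∈ᵛ Γ → suc x ⦂ wk A ∈ᵛ (Γ , B)
  there# : {Γ : Ctx λΠN n m} {A : Exp λΠN ty n m} {β : NameConst} {x : Fin n} →
           x ⦂ A ∈ᵛ Γ → x ⦂ wk# A ∈ᵛ (Γ # β)

data _⦂_∈#_ : Fin m → NameConst → Ctx λΠN n m → Set where
  here   : {Γ : Ctx λΠN n m} {α : NameConst} → zero ⦂ α ∈# (Γ # α)
  there  : {Γ : Ctx λΠN n m} {α : NameConst} {a : Fin m} {A : Exp λΠN ty n m} →
           a ⦂ α ∈# Γ → a ⦂ α ∈# (Γ , A)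
  there# : {Γ : Ctx λΠN n m} {α β : NameConst} {a : Fin m} →
           a ⦂ α ∈# Γ → suc a ⦂ α ∈# (Γ # β)

-- Restriction: Γ ⊢ a ⦂ α ╲ Γ′.
data _⊢_⦂_╲_ : Ctx λΠN n m → Fin m → NameConst → Ctx λΠN n′ m′ → Set where
  here  : {Γ : Ctx λΠN n m} {α : NameConst} → Γ # α ⊢ zero ⦂ α ╲ Γ
  skip# : {Γ : Ctx λΠN n m} {Γ′ : Ctx λΠN n′ m′} {a : Fin m} {α β : NameConst} →
          Γ ⊢ a ⦂ α ╲ Γ′ → Γ # β ⊢ suc a ⦂ α ╲ Γ′ # β
  skip  : {Γ : Ctx λΠN n m} {Γ′ : Ctx λΠN n′ m′} {a : Fin m} {α : NameConst}
          {A : Exp λΠN ty n m} →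
          Γ ⊢ a ⦂ α ╲ Γ′ → Γ , A ⊢ a ⦂ α ╲ Γ′

-- With explicit names an expression over Γ′ is literally one over Γ; with
-- indices the inclusion of Γ′ in Γ has to be applied.
varEmb : {Γ : Ctx λΠN n m} {Γ′ : Ctx λΠN n′ m′} {a : Fin m} {α : NameConst} →
         Γ ⊢ a ⦂ α ╲ Γ′ → Fin n′ → Fin n
varEmb here      = id
varEmb (skip# r) = varEmb r
varEmb (skip r)  = suc ∘ varEmb r

nameEmb : {Γ : Ctx λΠN n m} {Γ′ : Ctx λΠN n′ m′} {a : Fin m} {α : NameConst} →
          Γ ⊢ a ⦂ α ╲ Γ′ → Fin m′ → Fin m
nameEmb here      = suc
nameEmb (skip# r) = lift 1 (nameEmb r)
nameEmb (skip r)  = nameEmb r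

incl : {Γ : Ctx λΠN n m} {Γ′ : Ctx λΠN n′ m′} {a : Fin m} {α : NameConst} →
       Γ ⊢ a ⦂ α ╲ Γ′ → Exp λΠN s n′ m′ → Exp λΠN s n m
incl r = ren (varEmb r) (nameEmb r)

incl# : {Γ : Ctx λΠN n m} {Γ′ : Ctx λΠN n′ m′} {a : Fin m} {α : NameConst} →
        Γ ⊢ a ⦂ α ╲ Γ′ → Exp λΠN s n′ (suc m′) → Exp λΠN s n (suc m)
incl# r = ren (varEmb r) (lift 1 (nameEmb r))

infix 5 _∶kind _∶∶_ _∶_ _≐_∶kind _≐_∶∶_ _≐_∶_
data Assertion (ℓ : Lang) (n m : ℕ) : Set where
  _∶kind   : Exp ℓ kind n m → Assertion ℓ n m
  _∶∶_     : Exp ℓ ty n m → Exp ℓ kind n m → Assertion ℓ n m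
  _∶_      : Exp ℓ obj n m → Exp ℓ ty n m → Assertion ℓ n m
  _≐_∶kind : Exp ℓ kind n m → Exp ℓ kind n m → Assertion ℓ n m
  _≐_∶∶_   : Exp ℓ ty n m → Exp ℓ ty n m → Exp ℓ kind n m → Assertion ℓ n m
  _≐_∶_    : Exp ℓ obj n m → Exp ℓ obj n m → Exp ℓ ty n m → Assertion ℓ n m

-- The implicit well-formedness of contexts is enforced by a premise in every
-- rule that has no other premise over (an extension of) the context of its
-- conclusion, so Σ ∣ Γ ⊢ J is derivable only if Σ ⊢ctx Γ is.
infix 4 _⊢ctx_ _∣_⊢_
data _⊢ctx_ : Sig ℓ → Ctx ℓ n m → Set
data _∣_⊢_  : Sig ℓ → Ctx ℓ n m → Assertion ℓ n m → Set

private variable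
  Σ : Sig ℓ
  Γ Γ′ : Ctx ℓ n m
  K K′ K″ L : Exp ℓ kind n m
  A A′ A″ A₁ A₂ B B₁ B₂ C : Exp ℓ ty n m
  M M′ M″ M₁ M₂ N N₁ N₂ : Exp ℓ obj n m
  a : TyConst
  c : ObjConst
  α : NameConst
  x : Fin n
  b : Fin m

data _⊢ctx_ where
  ctx-ε : Σ ⊢ctx ε
  ctx-, : Σ ⊢ctx Γ → Σ ∣ Γ ⊢ A ∶∶ type → Σ ⊢ctx Γ , A
  ctx-# : Σ ⊢ctx Γ → α ⦂name ∈ Σ → Σ ⊢ctx Γ # α

data _∣_⊢_ where

  -- Formation of kinds
  type-k : Σ ⊢ctx Γ → Σ ∣ Γ ⊢ type ∶kind
  Π-k    : Σ ∣ Γ ⊢ A ∶∶ type → Σ ∣ Γ , A ⊢ K ∶kind → Σ ∣ Γ ⊢ Πᵏ A K ∶kind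

  -- Formation of types
  tcon-t : Σ ⊢ctx Γ → a ⦂⦂ K ∈ Σ → Σ ∣ Γ ⊢ tcon a ∶∶ closed K
  app-t  : Σ ∣ Γ ⊢ A ∶∶ Πᵏ B K → Σ ∣ Γ ⊢ M ∶ B → Σ ∣ Γ ⊢ A • M ∶∶ K [ M ]
  Π-t    : Σ ∣ Γ ⊢ A ∶∶ type → Σ ∣ Γ , A ⊢ B ∶∶ type → Σ ∣ Γ ⊢ Π A B ∶∶ type
  nty-t  : Σ ⊢ctx Γ → α ⦂name ∈ Σ → Σ ∣ Γ ⊢ nty α ∶∶ type
  New-t  : α ⦂name ∈ Σ → Σ ∣ Γ # α ⊢ B ∶∶ type → Σ ∣ Γ ⊢ New α B ∶∶ type
  conv-t : Σ ∣ Γ ⊢ A ∶∶ K′ → Σ ∣ Γ ⊢ K ≐ K′ ∶kind → Σ ∣ Γ ⊢ A ∶∶ K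

  -- Formation of objects
  con-o  : Σ ⊢ctx Γ → c ⦂ A ∈ Σ → Σ ∣ Γ ⊢ con c ∶ closed A
  var-o  : Σ ⊢ctx Γ → x ⦂ A ∈ᵛ Γ → Σ ∣ Γ ⊢ var x ∶ A
  name-o : Σ ⊢ctx Γ → b ⦂ α ∈# Γ → Σ ∣ Γ ⊢ name b ∶ nty α
  ƛ-o    : Σ ∣ Γ ⊢ A ∶∶ type → Σ ∣ Γ , A ⊢ M ∶ B → Σ ∣ Γ ⊢ ƛ A M ∶ Π A B
  app-o  : Σ ∣ Γ ⊢ M ∶ Π A B → Σ ∣ Γ ⊢ N ∶ A → Σ ∣ Γ ⊢ M · N ∶ B [ N ]
  abs-o  : α ⦂name ∈ Σ → Σ ∣ Γ # α ⊢ M ∶ B → Σ ∣ Γ ⊢ ⟨ α ⟩ M ∶ New α B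
  conc-o : Σ ⊢ctx Γ → (r : Γ ⊢ b ⦂ α ╲ Γ′) → Σ ∣ Γ′ ⊢ M ∶ New α B →
           Σ ∣ Γ ⊢ incl r M ＠ b ∶ incl# r B [ b ]#
  conv-o : Σ ∣ Γ ⊢ M ∶ A → Σ ∣ Γ ⊢ A ≐ B ∶∶ type → Σ ∣ Γ ⊢ M ∶ B

  -- Equality of kinds
  sym-k   : Σ ∣ Γ ⊢ K ≐ K′ ∶kind → Σ ∣ Γ ⊢ K′ ≐ K ∶kind
  trans-k : Σ ∣ Γ ⊢ K ≐ K′ ∶kind → Σ ∣ Γ ⊢ K′ ≐ K″ ∶kind → Σ ∣ Γ ⊢ K ≐ K″ ∶kind
  type-≐k : Σ ⊢ctx Γ → Σ ∣ Γ ⊢ type ≐ type ∶kind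
  Π-≐k    : Σ ∣ Γ ⊢ A ∶∶ type → Σ ∣ Γ ⊢ A ≐ B ∶∶ type → Σ ∣ Γ , A ⊢ K ≐ L ∶kind →
            Σ ∣ Γ ⊢ Πᵏ A K ≐ Πᵏ B L ∶kind

  -- Equality of types
  sym-t   : Σ ∣ Γ ⊢ A ≐ B ∶∶ K → Σ ∣ Γ ⊢ B ≐ A ∶∶ K
  trans-t : Σ ∣ Γ ⊢ A ≐ B ∶∶ K → Σ ∣ Γ ⊢ B ≐ C ∶∶ K → Σ ∣ Γ ⊢ A ≐ C ∶∶ K
  conv-≐t : Σ ∣ Γ ⊢ A ≐ B ∶∶ K → Σ ∣ Γ ⊢ K ≐ L ∶kind → Σ ∣ Γ ⊢ A ≐ B ∶∶ L
  tcon-≐t : Σ ⊢ctx Γ → a ⦂⦂ K ∈ Σ → Σ ∣ Γ ⊢ tcon a ≐ tcon a ∶∶ closed K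
  app-≐t  : Σ ∣ Γ ⊢ A ≐ B ∶∶ Πᵏ C K → Σ ∣ Γ ⊢ M ≐ N ∶ C →
            Σ ∣ Γ ⊢ A • M ≐ B • N ∶∶ K [ M ]
  Π-≐t    : Σ ∣ Γ ⊢ A₁ ∶∶ type → Σ ∣ Γ ⊢ A₁ ≐ B₁ ∶∶ type →
            Σ ∣ Γ , A₁ ⊢ A₂ ≐ B₂ ∶∶ type → Σ ∣ Γ ⊢ Π A₁ A₂ ≐ Π B₁ B₂ ∶∶ type
  ext-≐t  : Σ ∣ Γ , B ⊢ wk A₁ • var zero ≐ wk A₂ • var zero ∶∶ K →
            Σ ∣ Γ ⊢ A₁ ≐ A₂ ∶∶ Πᵏ B K
  nty-≐t  : Σ ⊢ctx Γ → α ⦂name ∈ Σ → Σ ∣ Γ ⊢ nty α ≐ nty α ∶∶ type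
  New-≐t  : Σ ∣ Γ # α ⊢ A ≐ B ∶∶ type → Σ ∣ Γ ⊢ New α A ≐ New α B ∶∶ type

  -- Equality of objects
  sym-o   : Σ ∣ Γ ⊢ M ≐ N ∶ A → Σ ∣ Γ ⊢ N ≐ M ∶ A
  trans-o : Σ ∣ Γ ⊢ M ≐ M′ ∶ A → Σ ∣ Γ ⊢ M′ ≐ M″ ∶ A → Σ ∣ Γ ⊢ M ≐ M″ ∶ A
  conv-≐o : Σ ∣ Γ ⊢ M ≐ N ∶ A → Σ ∣ Γ ⊢ A ≐ B ∶∶ type → Σ ∣ Γ ⊢ M ≐ N ∶ B
  var-≐o  : Σ ⊢ctx Γ → x ⦂ A ∈ᵛ Γ → Σ ∣ Γ ⊢ var x ≐ var x ∶ A
  con-≐o  : Σ ⊢ctx Γ → c ⦂ A ∈ Σ → Σ ∣ Γ ⊢ con c ≐ con c ∶ closed A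
  app-≐o  : Σ ∣ Γ ⊢ M₁ ≐ N₁ ∶ Π A B → Σ ∣ Γ ⊢ M₂ ≐ N₂ ∶ A →
            Σ ∣ Γ ⊢ M₁ · M₂ ≐ N₁ · N₂ ∶ B [ M₂ ]
  ƛ-≐o    : Σ ∣ Γ ⊢ A′ ≐ A ∶∶ type → Σ ∣ Γ ⊢ A″ ≐ A ∶∶ type →
            Σ ∣ Γ , A ⊢ M ≐ N ∶ B → Σ ∣ Γ ⊢ ƛ A′ M ≐ ƛ A″ N ∶ Π A B
  β-≐o    : Σ ∣ Γ ⊢ A ∶∶ type → Σ ∣ Γ , A ⊢ M₂ ≐ N₂ ∶ B → Σ ∣ Γ ⊢ M₁ ≐ N₁ ∶ A →
            Σ ∣ Γ ⊢ ƛ A M₂ · M₁ ≐ N₂ [ N₁ ] ∶ B [ M₁ ]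
  ext-≐o  : Σ ∣ Γ ⊢ A ∶∶ type → Σ ∣ Γ ⊢ M ∶ Π A B → Σ ∣ Γ ⊢ N ∶ Π A B →
            Σ ∣ Γ , A ⊢ wk M · var zero ≐ wk N · var zero ∶ B →
            Σ ∣ Γ ⊢ M ≐ N ∶ Π A B
  name-≐o : Σ ⊢ctx Γ → b ⦂ α ∈# Γ → Σ ∣ Γ ⊢ name b ≐ name b ∶ nty α
  abs-≐o  : Σ ∣ Γ # α ⊢ M ≐ N ∶ A → Σ ∣ Γ ⊢ ⟨ α ⟩ M ≐ ⟨ α ⟩ N ∶ New α A
  conc-≐o : Σ ⊢ctx Γ → (r : Γ ⊢ b ⦂ α ╲ Γ′) → Σ ∣ Γ′ ⊢ M ≐ N ∶ New α A →
            Σ ∣ Γ ⊢ incl r M ＠ b ≐ incl r N ＠ b ∶ incl# r A [ b ]#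
  βⁿ-≐o   : Σ ⊢ctx Γ → (r : Γ ⊢ b ⦂ α ╲ Γ′) → Σ ∣ Γ′ # α ⊢ M ≐ N ∶ A →
            Σ ∣ Γ ⊢ incl r (⟨ α ⟩ M) ＠ b ≐ incl# r N [ b ]# ∶ incl# r A [ b ]#
  extⁿ-≐o : Σ ∣ Γ # α ⊢ wk# M ＠ zero ≐ wk# N ＠ zero ∶ A → Σ ∣ Γ ⊢ M ≐ N ∶ New α A

infix 4 _sig
data _sig : Sig ℓ → Set where
  sig-[]   : _sig {ℓ} []
  sig-ty   : Σ sig → (∀ {L} → a ⦂⦂ L ∉ Σ) → Σ ∣ ε ⊢ K ∶kind → (a ⦂⦂ K) ∷ Σ sig
  sig-obj  : Σ sig → (∀ {B} → c ⦂ B ∉ Σ) → Σ ∣ ε ⊢ A ∶∶ type → (c ⦂ A) ∷ Σ sig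
  sig-name : Σ sig → α ⦂name ∉ Σ → (α ⦂name) ∷ Σ sig

-- The inclusion of LF in λΠN.
⌜_⌝ : Exp LF s n m → Exp λΠN s n m
⌜ type ⌝   = type
⌜ Πᵏ A K ⌝ = Πᵏ ⌜ A ⌝ ⌜ K ⌝
⌜ tcon a ⌝ = tcon a
⌜ A • M ⌝  = ⌜ A ⌝ • ⌜ M ⌝
⌜ Π A B ⌝  = Π ⌜ A ⌝ ⌜ B ⌝
⌜ con c ⌝  = con c
⌜ var x ⌝  = var x
⌜ ƛ A M ⌝  = ƛ ⌜ A ⌝ ⌜ M ⌝
⌜ M · N ⌝  = ⌜ M ⌝ · ⌜ N ⌝

⌜_⌝ᵈ : Decl LF → Decl λΠN
⌜ c ⦂ A ⌝ᵈ  = c ⦂ ⌜ A ⌝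
⌜ a ⦂⦂ K ⌝ᵈ = a ⦂⦂ ⌜ K ⌝

⌜_⌝ˢ : Sig LF → Sig λΠN
⌜_⌝ˢ = map ⌜_⌝ᵈ

⌜_⌝ᶜ : Ctx LF n m → Ctx λΠN n m
⌜ ε ⌝ᶜ     = ε
⌜ Γ , A ⌝ᶜ = ⌜ Γ ⌝ᶜ , ⌜ A ⌝

⌜_⌝ʲ : Assertion LF n m → Assertion λΠN n m
⌜ K ∶kind ⌝ʲ     = ⌜ K ⌝ ∶kind
⌜ A ∶∶ K ⌝ʲ      = ⌜ A ⌝ ∶∶ ⌜ K ⌝
⌜ M ∶ A ⌝ʲ       = ⌜ M ⌝ ∶ ⌜ A ⌝
⌜ K ≐ L ∶kind ⌝ʲ = ⌜ K ⌝ ≐ ⌜ L ⌝ ∶kind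
⌜ A ≐ B ∶∶ K ⌝ʲ  = ⌜ A ⌝ ≐ ⌜ B ⌝ ∶∶ ⌜ K ⌝
⌜ M ≐ N ∶ A ⌝ʲ   = ⌜ M ⌝ ≐ ⌜ N ⌝ ∶ ⌜ A ⌝

{-# OPTIONS --safe #-}
module Submission where

-- Erasing New-types, name-abstractions and concretions (and sending name types
-- and names to arbitrary constants) is a left inverse of the inclusion of LF
-- and commutes with renaming and substitution.  Over a signature without name
-- types no well-formed context contains a name, so the rules that use a
-- declared name type, a name or a restriction are void, while erasure turns
-- each remaining rule into an LF rule or into a rule with equal premise and
-- conclusion.

open import Data.Empty using (⊥; ⊥-elim)
open import Data.Fin using (Fin; zero; suc; lift)
open import Data.List using (_∷_)
open import Data.List.Membership.Propositional using (_∈_)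
open import Data.List.Relation.Unary.Any using (here; there)
open import Data.Nat using (ℕ; suc)
open import Function using (id)
open import Relation.Binary.PropositionalEquality
  using (_≡_; _≗_; refl; trans; cong; cong₂; subst)
open import Defs

private variable
  s : Sort
  n m n′ m′ : ℕ
  Σ : Sig LF

-- The name scope of the result is 0, the only one an LF context can have. Variables and names are
-- scoped independently, so dropping a name binder leaves every variable index unchanged.
⌞_⌟ : Exp λΠN s n m → Exp LF s n 0
⌞ type ⌟    = type
⌞ Πᵏ A K ⌟  = Πᵏ ⌞ A ⌟ ⌞ K ⌟
⌞ tcon a ⌟  = tcon a
⌞ A • M ⌟   = ⌞ A ⌟ • ⌞ M ⌟
⌞ Π A B ⌟   = Π ⌞ A ⌟ ⌞ B ⌟
⌞ nty α ⌟   = tcon 0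
⌞ New α B ⌟ = ⌞ B ⌟
⌞ con c ⌟   = con c
⌞ var x ⌟   = var x
⌞ ƛ A M ⌟   = ƛ ⌞ A ⌟ ⌞ M ⌟
⌞ M · N ⌟   = ⌞ M ⌟ · ⌞ N ⌟
⌞ name a ⌟  = con 0
⌞ ⟨ α ⟩ M ⌟ = ⌞ M ⌟
⌞ M ＠ a ⌟  = ⌞ M ⌟

⌞_⌟ᶜ : Ctx λΠN n m → Ctx LF n 0
⌞ ε ⌟ᶜ     = ε
⌞ Γ , A ⌟ᶜ = ⌞ Γ ⌟ᶜ , ⌞ A ⌟
⌞ Γ # α ⌟ᶜ = ⌞ Γ ⌟ᶜ

⌞_⌟ʲ : Assertion λΠN n m → Assertion LF n 0
⌞ K ∶kind ⌟ʲ     = ⌞ K ⌟ ∶kind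
⌞ A ∶∶ K ⌟ʲ      = ⌞ A ⌟ ∶∶ ⌞ K ⌟
⌞ M ∶ A ⌟ʲ       = ⌞ M ⌟ ∶ ⌞ A ⌟
⌞ K ≐ L ∶kind ⌟ʲ = ⌞ K ⌟ ≐ ⌞ L ⌟ ∶kind
⌞ A ≐ B ∶∶ K ⌟ʲ  = ⌞ A ⌟ ≐ ⌞ B ⌟ ∶∶ ⌞ K ⌟
⌞ M ≐ N ∶ A ⌟ʲ   = ⌞ M ⌟ ≐ ⌞ N ⌟ ∶ ⌞ A ⌟

⌞⌜_⌝⌟ : (E : Exp LF s n 0) → ⌞ ⌜ E ⌝ ⌟ ≡ E
⌞⌜ type ⌝⌟   = refl
⌞⌜ Πᵏ A K ⌝⌟ = cong₂ Πᵏ ⌞⌜ A ⌝⌟ ⌞⌜ K ⌝⌟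
⌞⌜ tcon a ⌝⌟ = refl
⌞⌜ A • M ⌝⌟  = cong₂ _•_ ⌞⌜ A ⌝⌟ ⌞⌜ M ⌝⌟
⌞⌜ Π A B ⌝⌟  = cong₂ Π ⌞⌜ A ⌝⌟ ⌞⌜ B ⌝⌟
⌞⌜ con c ⌝⌟  = refl
⌞⌜ var x ⌝⌟  = refl
⌞⌜ ƛ A M ⌝⌟  = cong₂ ƛ ⌞⌜ A ⌝⌟ ⌞⌜ M ⌝⌟
⌞⌜ M · N ⌝⌟  = cong₂ _·_ ⌞⌜ M ⌝⌟ ⌞⌜ N ⌝⌟

⌞⌜_⌝⌟ᶜ : (Γ : Ctx LF n 0) → ⌞ ⌜ Γ ⌝ᶜ ⌟ᶜ ≡ Γ
⌞⌜ ε ⌝⌟ᶜ     = refl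
⌞⌜ Γ , A ⌝⌟ᶜ = cong₂ _,_ ⌞⌜ Γ ⌝⌟ᶜ ⌞⌜ A ⌝⌟

⌞⌜_⌝⌟ʲ : (J : Assertion LF n 0) → ⌞ ⌜ J ⌝ʲ ⌟ʲ ≡ J
⌞⌜ K ∶kind ⌝⌟ʲ     = cong _∶kind ⌞⌜ K ⌝⌟
⌞⌜ A ∶∶ K ⌝⌟ʲ      = cong₂ _∶∶_ ⌞⌜ A ⌝⌟ ⌞⌜ K ⌝⌟
⌞⌜ M ∶ A ⌝⌟ʲ       = cong₂ _∶_ ⌞⌜ M ⌝⌟ ⌞⌜ A ⌝⌟
⌞⌜ K ≐ L ∶kind ⌝⌟ʲ = cong₂ _≐_∶kind ⌞⌜ K ⌝⌟ ⌞⌜ L ⌝⌟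
⌞⌜ A ≐ B ∶∶ K ⌝⌟ʲ  rewrite ⌞⌜ A ⌝⌟ | ⌞⌜ B ⌝⌟ | ⌞⌜ K ⌝⌟ = refl
⌞⌜ M ≐ N ∶ A ⌝⌟ʲ   rewrite ⌞⌜ M ⌝⌟ | ⌞⌜ N ⌝⌟ | ⌞⌜ A ⌝⌟ = refl

lift-cong : {ξ ξ′ : Fin n → Fin n′} → ξ ≗ ξ′ → lift 1 ξ ≗ lift 1 ξ′
lift-cong eq zero    = refl
lift-cong eq (suc x) = cong suc (eq x)

lift-id : {ξ : Fin n → Fin n} → ξ ≗ id → lift 1 ξ ≗ id
lift-id eq zero    = refl
lift-id eq (suc x) = cong suc (eq x)

-- `ρ` is arbitrary because an LF expression contains no names. The condition on `ξ` is pointwise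
-- because lifting the identity under a binder yields the identity only pointwise.
ren-id : {ξ : Fin n → Fin n} {ρ : Fin m → Fin m} → ξ ≗ id →
         (E : Exp LF s n m) → ren ξ ρ E ≡ E
ren-id eq type     = refl
ren-id eq (Πᵏ A K) = cong₂ Πᵏ (ren-id eq A) (ren-id (lift-id eq) K)
ren-id eq (tcon a) = refl
ren-id eq (A • M)  = cong₂ _•_ (ren-id eq A) (ren-id eq M)
ren-id eq (Π A B)  = cong₂ Π (ren-id eq A) (ren-id (lift-id eq) B)
ren-id eq (con c)  = refl
ren-id eq (var x)  = cong var (eq x)
ren-id eq (ƛ A M)  = cong₂ ƛ (ren-id eq A) (ren-id (lift-id eq) M)
ren-id eq (M · N)  = cong₂ _·_ (ren-id eq M) (ren-id eq N)

-- `ρ` and `ρ′` are unrelated, since an erased expression has no name for either to act on.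
⌞⌟-ren : {ξ ξ′ : Fin n → Fin n′} {ρ : Fin m → Fin m′} {ρ′ : Fin 0 → Fin 0} →
         ξ ≗ ξ′ → (E : Exp λΠN s n m) → ⌞ ren ξ ρ E ⌟ ≡ ren ξ′ ρ′ ⌞ E ⌟
⌞⌟-ren eq type      = refl
⌞⌟-ren eq (Πᵏ A K)  = cong₂ Πᵏ (⌞⌟-ren eq A) (⌞⌟-ren (lift-cong eq) K)
⌞⌟-ren eq (tcon a)  = refl
⌞⌟-ren eq (A • M)   = cong₂ _•_ (⌞⌟-ren eq A) (⌞⌟-ren eq M)
⌞⌟-ren eq (Π A B)   = cong₂ Π (⌞⌟-ren eq A) (⌞⌟-ren (lift-cong eq) B)
⌞⌟-ren eq (nty α)   = refl
⌞⌟-ren eq (New α B) = ⌞⌟-ren eq B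
⌞⌟-ren eq (con c)   = refl
⌞⌟-ren eq (var x)   = cong var (eq x)
⌞⌟-ren eq (ƛ A M)   = cong₂ ƛ (⌞⌟-ren eq A) (⌞⌟-ren (lift-cong eq) M)
⌞⌟-ren eq (M · N)   = cong₂ _·_ (⌞⌟-ren eq M) (⌞⌟-ren eq N)
⌞⌟-ren eq (name a)  = refl
⌞⌟-ren eq (⟨ α ⟩ M) = ⌞⌟-ren eq M
⌞⌟-ren eq (M ＠ a)  = ⌞⌟-ren eq M

⌞⌟-wk : (E : Exp λΠN s n m) → ⌞ wk E ⌟ ≡ wk ⌞ E ⌟
⌞⌟-wk = ⌞⌟-ren λ _ → refl

⌞⌟-wk# : (E : Exp λΠN s n m) → ⌞ wk# E ⌟ ≡ ⌞ E ⌟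
⌞⌟-wk# E = trans (⌞⌟-ren {ρ′ = id} (λ _ → refl) E) (ren-id (λ _ → refl) ⌞ E ⌟)

⌞⌟-closed : (E : Exp λΠN s 0 0) → ⌞ closed {n = n} {m = m} E ⌟ ≡ closed ⌞ E ⌟
⌞⌟-closed = ⌞⌟-ren λ ()

⌞⌟-exts : {σ : Fin n → Exp λΠN obj n′ m} {τ : Fin n → Exp LF obj n′ 0} →
          (∀ x → ⌞ σ x ⌟ ≡ τ x) → ∀ x → ⌞ exts σ x ⌟ ≡ exts τ x
⌞⌟-exts eq zero            = refl
⌞⌟-exts {σ = σ} eq (suc x) = trans (⌞⌟-wk (σ x)) (cong wk (eq x))

-- Serves the name-binding cases of substitution: going under the binder weakens `σ` by a name,
-- while erasure removes the binder, so the same `τ` must still match.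
⌞⌟-wk#∘ : (σ : Fin n → Exp λΠN obj n′ m) {τ : Fin n → Exp LF obj n′ 0} →
          (∀ x → ⌞ σ x ⌟ ≡ τ x) → ∀ x → ⌞ wk# (σ x) ⌟ ≡ τ x
⌞⌟-wk#∘ σ eq x = trans (⌞⌟-wk# (σ x)) (eq x)

⌞⌟-sub : {σ : Fin n → Exp λΠN obj n′ m} {τ : Fin n → Exp LF obj n′ 0} →
         (∀ x → ⌞ σ x ⌟ ≡ τ x) → (E : Exp λΠN s n m) → ⌞ sub σ E ⌟ ≡ sub τ ⌞ E ⌟
⌞⌟-sub eq type      = refl
⌞⌟-sub eq (Πᵏ A K)  = cong₂ Πᵏ (⌞⌟-sub eq A) (⌞⌟-sub (⌞⌟-exts eq) K)
⌞⌟-sub eq (tcon a)  = refl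
⌞⌟-sub eq (A • M)   = cong₂ _•_ (⌞⌟-sub eq A) (⌞⌟-sub eq M)
⌞⌟-sub eq (Π A B)   = cong₂ Π (⌞⌟-sub eq A) (⌞⌟-sub (⌞⌟-exts eq) B)
⌞⌟-sub eq (nty α)   = refl
⌞⌟-sub {σ = σ} eq (New α B) = ⌞⌟-sub (⌞⌟-wk#∘ σ eq) B
⌞⌟-sub eq (con c)   = refl
⌞⌟-sub eq (var x)   = eq x
⌞⌟-sub eq (ƛ A M)   = cong₂ ƛ (⌞⌟-sub eq A) (⌞⌟-sub (⌞⌟-exts eq) M)
⌞⌟-sub eq (M · N)   = cong₂ _·_ (⌞⌟-sub eq M) (⌞⌟-sub eq N)
⌞⌟-sub eq (name a)  = refl
⌞⌟-sub {σ = σ} eq (⟨ α ⟩ M) = ⌞⌟-sub (⌞⌟-wk#∘ σ eq) M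
⌞⌟-sub eq (M ＠ a)  = ⌞⌟-sub eq M

⌞⌟-[] : (E : Exp λΠN s (suc n) m) (M : Exp λΠN obj n m) →
        ⌞ E [ M ] ⌟ ≡ ⌞ E ⌟ [ ⌞ M ⌟ ]
⌞⌟-[] E M = ⌞⌟-sub (λ { zero → refl ; (suc x) → refl }) E

⌞⌟-∈ᵛ : {Γ : Ctx λΠN n m} {A : Exp λΠN ty n m} {x : Fin n} →
        x ⦂ A ∈ᵛ Γ → x ⦂ ⌞ A ⌟ ∈ᵛ ⌞ Γ ⌟ᶜ
⌞⌟-∈ᵛ (here {A = A}) rewrite ⌞⌟-wk A = here
⌞⌟-∈ᵛ (there {A = A} x∈) rewrite ⌞⌟-wk A = there (⌞⌟-∈ᵛ x∈)
-- A `#` entry is absent from the erased context, so the variable keeps its position.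
⌞⌟-∈ᵛ (there# {A = A} x∈) rewrite ⌞⌟-wk# A = ⌞⌟-∈ᵛ x∈

-- Each declaration of `⌜ Σ ⌝ˢ` is the image of one in `Σ`, which erasure recovers.
⌞⌟-tcon∈ : ∀ {a K} → a ⦂⦂ K ∈ ⌜ Σ ⌝ˢ → a ⦂⦂ ⌞ K ⌟ ∈ Σ
⌞⌟-tcon∈ {Σ = (a ⦂⦂ K) ∷ _} (here refl) = here (cong (a ⦂⦂_) ⌞⌜ K ⌝⌟)
⌞⌟-tcon∈ {Σ = _ ∷ _}        (there a∈)  = there (⌞⌟-tcon∈ a∈)

⌞⌟-con∈ : ∀ {c A} → c ⦂ A ∈ ⌜ Σ ⌝ˢ → c ⦂ ⌞ A ⌟ ∈ Σ
⌞⌟-con∈ {Σ = (c ⦂ A) ∷ _} (here refl) = here (cong (c ⦂_) ⌞⌜ A ⌝⌟)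
⌞⌟-con∈ {Σ = _ ∷ _}       (there c∈)  = there (⌞⌟-con∈ c∈)

no-name-type : ∀ {α} → α ⦂name ∈ ⌜ Σ ⌝ˢ → ⊥
no-name-type {Σ = (_ ⦂ _) ∷ _}  (here ())
no-name-type {Σ = (_ ⦂⦂ _) ∷ _} (here ())
no-name-type {Σ = _ ∷ _}        (there α∈) = no-name-type α∈

-- The scope alone suffices: an element of `Fin m` forces a `#` entry in `Γ`, whose formation
-- requires a declared name type. Rules with a restriction are thus refuted without inspecting it,
-- and `incl` never has to be erased.
no-name : {Γ : Ctx λΠN n m} → ⌜ Σ ⌝ˢ ⊢ctx Γ → Fin m → ⊥
no-name (ctx-, ⊢Γ _) b = no-name ⊢Γ b
no-name (ctx-# _ α∈) _ = no-name-type α∈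

⌞⌟-⊢ctx : {Γ : Ctx λΠN n m} → ⌜ Σ ⌝ˢ ⊢ctx Γ → Σ ⊢ctx ⌞ Γ ⌟ᶜ
-- By induction on the derivation, for all `Γ` and `J`: premises are not visibly LF judgments, as
-- the middle term of transitivity may be any λΠN expression.
⌞⌟-⊢ : {Γ : Ctx λΠN n m} {J : Assertion λΠN n m} →
       ⌜ Σ ⌝ˢ ∣ Γ ⊢ J → Σ ∣ ⌞ Γ ⌟ᶜ ⊢ ⌞ J ⌟ʲ

⌞⌟-⊢ctx ctx-ε        = ctx-ε
⌞⌟-⊢ctx (ctx-, ⊢Γ A) = ctx-, (⌞⌟-⊢ctx ⊢Γ) (⌞⌟-⊢ A)
⌞⌟-⊢ctx (ctx-# ⊢Γ _) = ⌞⌟-⊢ctx ⊢Γ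

⌞⌟-⊢ (type-k ⊢Γ) = type-k (⌞⌟-⊢ctx ⊢Γ)
⌞⌟-⊢ (Π-k A K)   = Π-k (⌞⌟-⊢ A) (⌞⌟-⊢ K)

⌞⌟-⊢ {n = n} {m = m} (tcon-t {K = K} ⊢Γ a∈)
  rewrite ⌞⌟-closed {n = n} {m = m} K = tcon-t (⌞⌟-⊢ctx ⊢Γ) (⌞⌟-tcon∈ a∈)
⌞⌟-⊢ (app-t {K = K} {M = M} ⊢A ⊢M)
  rewrite ⌞⌟-[] K M = app-t (⌞⌟-⊢ ⊢A) (⌞⌟-⊢ ⊢M)
⌞⌟-⊢ (Π-t A B)     = Π-t (⌞⌟-⊢ A) (⌞⌟-⊢ B)
⌞⌟-⊢ (nty-t _ α∈)  = ⊥-elim (no-name-type α∈)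
⌞⌟-⊢ (New-t _ B)   = ⌞⌟-⊢ B
⌞⌟-⊢ (conv-t A eq) = conv-t (⌞⌟-⊢ A) (⌞⌟-⊢ eq)

⌞⌟-⊢ {n = n} {m = m} (con-o {A = A} ⊢Γ c∈)
  rewrite ⌞⌟-closed {n = n} {m = m} A = con-o (⌞⌟-⊢ctx ⊢Γ) (⌞⌟-con∈ c∈)
⌞⌟-⊢ (var-o ⊢Γ x∈)     = var-o (⌞⌟-⊢ctx ⊢Γ) (⌞⌟-∈ᵛ x∈)
⌞⌟-⊢ (name-o {b = b} ⊢Γ _) = ⊥-elim (no-name ⊢Γ b)
⌞⌟-⊢ (ƛ-o A M)         = ƛ-o (⌞⌟-⊢ A) (⌞⌟-⊢ M)
⌞⌟-⊢ (app-o {B = B} {N = N} ⊢M ⊢N)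
  rewrite ⌞⌟-[] B N = app-o (⌞⌟-⊢ ⊢M) (⌞⌟-⊢ ⊢N)
⌞⌟-⊢ (abs-o _ M)       = ⌞⌟-⊢ M
⌞⌟-⊢ (conc-o {b = b} ⊢Γ _ _) = ⊥-elim (no-name ⊢Γ b)
⌞⌟-⊢ (conv-o M eq)     = conv-o (⌞⌟-⊢ M) (⌞⌟-⊢ eq)

⌞⌟-⊢ (sym-k eq)       = sym-k (⌞⌟-⊢ eq)
⌞⌟-⊢ (trans-k eq eq′) = trans-k (⌞⌟-⊢ eq) (⌞⌟-⊢ eq′)
⌞⌟-⊢ (type-≐k ⊢Γ)     = type-≐k (⌞⌟-⊢ctx ⊢Γ)
⌞⌟-⊢ (Π-≐k A eq eq′)  = Π-≐k (⌞⌟-⊢ A) (⌞⌟-⊢ eq) (⌞⌟-⊢ eq′)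

⌞⌟-⊢ (sym-t eq)       = sym-t (⌞⌟-⊢ eq)
⌞⌟-⊢ (trans-t eq eq′) = trans-t (⌞⌟-⊢ eq) (⌞⌟-⊢ eq′)
⌞⌟-⊢ (conv-≐t eq eq′) = conv-≐t (⌞⌟-⊢ eq) (⌞⌟-⊢ eq′)
⌞⌟-⊢ {n = n} {m = m} (tcon-≐t {K = K} ⊢Γ a∈)
  rewrite ⌞⌟-closed {n = n} {m = m} K = tcon-≐t (⌞⌟-⊢ctx ⊢Γ) (⌞⌟-tcon∈ a∈)
⌞⌟-⊢ (app-≐t {K = K} {M = M} eq eq′)
  rewrite ⌞⌟-[] K M = app-≐t (⌞⌟-⊢ eq) (⌞⌟-⊢ eq′)
⌞⌟-⊢ (Π-≐t A eq eq′)  = Π-≐t (⌞⌟-⊢ A) (⌞⌟-⊢ eq) (⌞⌟-⊢ eq′)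
⌞⌟-⊢ (ext-≐t {A₁ = A₁} {A₂ = A₂} eq)
  -- The premise must be rewritten too: it speaks of `⌞ wk A₁ ⌟`, whereas the LF rule expects
  -- `wk ⌞ A₁ ⌟`.
  with eq′ ← ⌞⌟-⊢ eq rewrite ⌞⌟-wk A₁ | ⌞⌟-wk A₂ = ext-≐t eq′
⌞⌟-⊢ (nty-≐t _ α∈)    = ⊥-elim (no-name-type α∈)
⌞⌟-⊢ (New-≐t eq)      = ⌞⌟-⊢ eq

⌞⌟-⊢ (sym-o eq)       = sym-o (⌞⌟-⊢ eq)
⌞⌟-⊢ (trans-o eq eq′) = trans-o (⌞⌟-⊢ eq) (⌞⌟-⊢ eq′)
⌞⌟-⊢ (conv-≐o eq eq′) = conv-≐o (⌞⌟-⊢ eq) (⌞⌟-⊢ eq′)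
⌞⌟-⊢ (var-≐o ⊢Γ x∈)   = var-≐o (⌞⌟-⊢ctx ⊢Γ) (⌞⌟-∈ᵛ x∈)
⌞⌟-⊢ {n = n} {m = m} (con-≐o {A = A} ⊢Γ c∈)
  rewrite ⌞⌟-closed {n = n} {m = m} A = con-≐o (⌞⌟-⊢ctx ⊢Γ) (⌞⌟-con∈ c∈)
⌞⌟-⊢ (app-≐o {B = B} {M₂ = M₂} eq eq′)
  rewrite ⌞⌟-[] B M₂ = app-≐o (⌞⌟-⊢ eq) (⌞⌟-⊢ eq′)
⌞⌟-⊢ (ƛ-≐o eq eq′ eq″) = ƛ-≐o (⌞⌟-⊢ eq) (⌞⌟-⊢ eq′) (⌞⌟-⊢ eq″)
⌞⌟-⊢ (β-≐o {N₂ = N₂} {B = B} {M₁ = M₁} {N₁ = N₁} A eq eq′)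
  rewrite ⌞⌟-[] N₂ N₁ | ⌞⌟-[] B M₁ = β-≐o (⌞⌟-⊢ A) (⌞⌟-⊢ eq) (⌞⌟-⊢ eq′)
⌞⌟-⊢ (ext-≐o {M = M} {N = N} ⊢A ⊢M ⊢N eq)
  with eq′ ← ⌞⌟-⊢ eq rewrite ⌞⌟-wk M | ⌞⌟-wk N =
  ext-≐o (⌞⌟-⊢ ⊢A) (⌞⌟-⊢ ⊢M) (⌞⌟-⊢ ⊢N) eq′
⌞⌟-⊢ (name-≐o {b = b} ⊢Γ _) = ⊥-elim (no-name ⊢Γ b)
⌞⌟-⊢ (abs-≐o eq)       = ⌞⌟-⊢ eq
⌞⌟-⊢ (conc-≐o {b = b} ⊢Γ _ _) = ⊥-elim (no-name ⊢Γ b)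
⌞⌟-⊢ (βⁿ-≐o {b = b} ⊢Γ _ _)   = ⊥-elim (no-name ⊢Γ b)
-- Concretion at the fresh name erases to `⌞ wk# M ⌟`, which is `⌞ M ⌟`, so the erased premise is
-- already the conclusion.
⌞⌟-⊢ (extⁿ-≐o {M = M} {N = N} eq)
  with eq′ ← ⌞⌟-⊢ eq rewrite ⌞⌟-wk# M | ⌞⌟-wk# N = eq′

-- Brings the given judgment into name scope 0, where erasure lands and where the left-inverse
-- equations are stated.
LF-ctx-nameless : Ctx LF n m → m ≡ 0
LF-ctx-nameless ε       = refl
LF-ctx-nameless (Γ , _) = LF-ctx-nameless Γ

corollary4p19 : ∀ {n m : ℕ} (Σ : Sig LF) (Γ : Ctx LF n m) (J : Assertion LF n m) →
    Σ sig → ⌜ Σ ⌝ˢ ∣ ⌜ Γ ⌝ᶜ ⊢ ⌜ J ⌝ʲ → Σ ∣ Γ ⊢ J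
corollary4p19 Σ Γ J _ ⊢J with refl ← LF-ctx-nameless Γ =
  subst (Σ ∣ Γ ⊢_) ⌞⌜ J ⌝⌟ʲ (subst (Σ ∣_⊢ ⌞ ⌜ J ⌝ʲ ⌟ʲ) ⌞⌜ Γ ⌝⌟ᶜ (⌞⌟-⊢ ⊢J))
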